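{- The following statements are equivalent for every graph $G$: (i) $G$ is $C_3$-pivot-minor-free. (ii) $G$ has no induced odd cycle. (iii) $G$ is bipartite.
   Context: Graphs are finite, without loops or multiple edges. $C_3$ is the cycle on three vertices; a cycle of length $3$ counts as an odd cycle. For a vertex $u$ of a graph $G$, the local complementation $G*u$ is obtained from $G$ by complementing the adjacency between every pair of distinct neighbours of $u$. For an edge $uv$ of $G$, the edge pivot is $G\wedge uv=((G*u)*v)*u$. A graph $G$ contains $H$ as a pivot-minor if $H$ can be obtained from $G$ by a sequence of vertex deletions and edge pivots; $G$ is $H$-pivot-minor-free if it contains no pivot-minor isomorphic to $H$. -}

module Defs where

open import Data.Bool using (Bool; true; false; T; _∧_; _∨_; not; if_then_else_)
open import Data.Bool.Properties using (∧-comm)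
open import Data.Fin using (Fin; toℕ; punchIn; _≟_)
open import Data.Fin.Subset using (Subset; _∈_; ∁)
open import Data.Nat using (ℕ; suc; _+_; _*_; _≤_; s≤s; ∣_-_∣; pred; _≡ᵇ_)
open import Data.Nat.Properties using (≤-refl; ∣-∣-comm; ∣n-n∣≡0)
open import Data.Product using (∃; ∃-syntax; Σ-syntax; _×_; _,_)
open import Function.Bundles using (_↔_; Inverse)
open import Function.Definitions using (Injective)
open import Relation.Binary.Construct.Closure.ReflexiveTransitive using (Star)
open import Relation.Binary.PropositionalEquality
  using (_≡_; refl; sym)
open import Relation.Nullary using (¬_; yes; no; does; contradiction)

record Graph (n : ℕ) : Set where
  field
    adj        : Fin n → Fin n → Bool
    adj-sym    : ∀ u v → adj u v ≡ adj v u
    adj-irrefl : ∀ v → adj v v ≡ false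

open Graph public

Adjacent : ∀ {n} → Graph n → Fin n → Fin n → Set
Adjacent G u v = T (adj G u v)

≟-does-sym : ∀ {n} (x y : Fin n) → does (x ≟ y) ≡ does (y ≟ x)
≟-does-sym x y with x ≟ y | y ≟ x
... | yes _   | yes _   = refl
... | no _    | no _    = refl
... | yes x≡y | no y≢x  = contradiction (sym x≡y) y≢x
... | no x≢y  | yes y≡x = contradiction (sym y≡x) x≢y

distinctNeighbours : ∀ {n} → Graph n → Fin n → Fin n → Fin n → Bool
distinctNeighbours G u x y = (adj G u x ∧ adj G u y) ∧ not (does (x ≟ y))

infixl 7 _✶_

_✶_ : ∀ {n} → Graph n → Fin n → Graph n
adj (G ✶ u) x y =
  if distinctNeighbours G u x y then not (adj G x y) else adj G x y
adj-sym (G ✶ u) x y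
  rewrite ∧-comm (adj G u x) (adj G u y) | ≟-does-sym x y | adj-sym G x y = refl
adj-irrefl (G ✶ u) x with x ≟ x
... | no x≢x = contradiction refl x≢x
... | yes _ rewrite ∧-comm (adj G u x ∧ adj G u x) false = adj-irrefl G x

pivot : ∀ {n} → Graph n → Fin n → Fin n → Graph n
pivot G u v = ((G ✶ u) ✶ v) ✶ u

delete : ∀ {n} → Graph (suc n) → Fin (suc n) → Graph n
adj        (delete G v) x y = adj G (punchIn v x) (punchIn v y)
adj-sym    (delete G v) x y = adj-sym G (punchIn v x) (punchIn v y)
adj-irrefl (delete G v) x   = adj-irrefl G (punchIn v x)

data Step : ∃ Graph → ∃ Graph → Set where
  deleteVertex : ∀ {n} (G : Graph (suc n)) (v : Fin (suc n)) →
                 Step (suc n , G) (n , delete G v)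
  pivotEdge    : ∀ {n} (G : Graph n) (u v : Fin n) → Adjacent G u v →
                 Step (n , G) (n , pivot G u v)

IsPivotMinorOf : ∀ {m n} → Graph m → Graph n → Set
IsPivotMinorOf {m} {n} K G = Star Step (n , G) (m , K)

_≅_ : ∀ {m n} → Graph m → Graph n → Set
_≅_ {m} {n} G H = Σ[ f ∈ Fin m ↔ Fin n ]
  (∀ x y → adj G x y ≡ adj H (Inverse.to f x) (Inverse.to f y))

PivotMinorFree : ∀ {m n} → Graph m → Graph n → Set
PivotMinorFree H G =
  ¬ (∃[ k ] Σ[ K ∈ Graph k ] IsPivotMinorOf K G × K ≅ H)

-- The vertices 0, …, n − 1 are in cyclic order, so i and j are adjacent iff
-- |i − j| is 1 or, for the closing edge between 0 and n − 1, equal to n − 1.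
cycle : ∀ n → 3 ≤ n → Graph n
adj (cycle n _) i j =
  (∣ toℕ i - toℕ j ∣ ≡ᵇ 1) ∨ (∣ toℕ i - toℕ j ∣ ≡ᵇ pred n)
adj-sym (cycle n _) i j rewrite ∣-∣-comm (toℕ i) (toℕ j) = refl
adj-irrefl (cycle _ (s≤s (s≤s _))) i rewrite ∣n-n∣≡0 (toℕ i) = refl

C₃ : Graph 3
C₃ = cycle 3 ≤-refl

IsInducedSubgraphOf : ∀ {m n} → Graph m → Graph n → Set
IsInducedSubgraphOf {m} {n} H G = Σ[ f ∈ (Fin m → Fin n) ]
  Injective _≡_ _≡_ f × (∀ x y → adj H x y ≡ adj G (f x) (f y))

Odd : ℕ → Set
Odd n = ∃[ k ] n ≡ 1 + 2 * k

HasInducedOddCycle : ∀ {n} → Graph n → Set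
HasInducedOddCycle G =
  ∃[ k ] Σ[ 3≤k ∈ 3 ≤ k ] Odd k × IsInducedSubgraphOf (cycle k 3≤k) G

Independent : ∀ {n} → Graph n → Subset n → Set
Independent G S = ∀ u v → u ∈ S → v ∈ S → ¬ Adjacent G u v

-- One of the two classes may be empty.
Bipartite : ∀ {n} → Graph n → Set
Bipartite {n} G = Σ[ S ∈ Subset n ] Independent G S × Independent G (∁ S)

{-# OPTIONS --safe #-}

-- A closed walk of minimal odd length traces an induced odd cycle, since coincidences and chords split
-- off a shorter odd closed walk; and a graph without odd closed walks is 2-coloured by the parities of
-- walks to a root of each component. Two-colourability survives vertex deletion, and it
-- survives pivoting uv, because every edge that appears closes a path x u v y or x v u y (or replaces
-- an edge at u by one at v, or conversely); as C₃ is not 2-colourable, bipartite graphs are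
-- C₃-pivot-minor-free. Finally, pivoting an edge of an induced C₅₊ₖ leaves an induced C₃₊ₖ on its
-- other vertices, so that an induced odd cycle yields C₃.

module Submission where

open import Defs
open import Data.Bool using (Bool; true; false; T; _∧_; _∨_; _xor_; if_then_else_)
open import Data.Bool.Properties
  using (T-≡; T-∨; T?; ¬-not; xor-identityʳ; ∧-identityʳ; ∧-zeroʳ)
open import Data.Bool.Solver using (module xor-∧-Solver)
open import Data.Fin using (Fin; zero; suc; toℕ; punchIn; punchOut; _≟_)
open import Data.Fin.Properties
  using ( any?; all?; ¬∀⟶∃¬; punchOut-injective; punchIn-punchOut
        ; toℕ<n; toℕ-injective; toℕ≤pred[n]; suc-injective)
open import Data.Fin.Subset using (Subset; _∈_; ∁)
open import Data.Fin.Subset.Properties using (_∈?_; x∈∁p⇒x∉p; x∉p⇒x∈∁p)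
open import Data.List using (List; []; _∷_; allFin; cartesianProduct)
open import Data.List.Membership.Propositional.Properties using (∈-allFin; ∈-cartesianProduct⁺)
open import Data.List.Relation.Unary.All as All using (All; []; _∷_)
open import Data.Nat
  using ( ℕ; zero; suc; _+_; _*_; _∸_; _≤_; _<_; z≤n; s≤s; ∣_-_∣; _≡ᵇ_
        ; pred; parity; >-nonZero)
open import Data.Nat.Induction using (<-rec)
open import Data.Nat.Properties
  using ( ≤-trans; ≤-antisym; <⇒≤; <⇒≢; <-cmp; ≮⇒≥; m<m+n; m<n+m; m≤m+n; m≤n+m; m≤n⇒m≤1+n
        ; +-suc; +-comm; +-assoc; +-identityʳ; *-suc; suc-pred
        ; +-cancelˡ-≡; +-cancelˡ-≤; +-cancelʳ-≤; m∸n+n≡m; m+[n∸m]≡n; m<n⇒0<n∸m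
        ; m≤n⇒∣m-n∣≡n∸m; ∣m-n∣≤m⊔n; ⊔-lub; ≡ᵇ⇒≡; ≡⇒≡ᵇ; anyUpTo?)
open import Data.Parity as ℙ using (Parity; 0ℙ; 1ℙ; _⁻¹)
import Data.Parity.Properties as ℙₚ
open import Data.Product using (∃-syntax; Σ-syntax; _×_; _,_; proj₁; proj₂)
open import Data.Sum as Sum using (_⊎_; inj₁; inj₂)
import Data.Vec as Vec
open import Data.Vec.Properties using ([]=⇒lookup; lookup⇒[]=; lookup∘tabulate)
open import Function using (_∘_)
open import Function.Bundles using (_⇔_; Inverse; mk⇔; mk↔ₛ′; Equivalence)
open import Function.Definitions using (Injective)
open import Relation.Binary.Construct.Closure.ReflexiveTransitive using (ε; _◅_)
open import Relation.Binary.Definitions using (tri<; tri≈; tri>)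
open import Relation.Binary.PropositionalEquality
  using (_≡_; _≢_; refl; sym; trans; cong; cong₂; subst; ≢-sym; module ≡-Reasoning)
open import Relation.Nullary using (¬_; Dec; yes; no; does; contradiction; _×-dec_)
open import Relation.Nullary.Decidable using (dec-true; dec-false; map′)

open ≡-Reasoning

private
  variable
    m n k l : ℕ
    G H : Graph n
    a b c u v x y : Fin n

-- Booleans and adjacency

T-injective : ∀ {p q} → (T p → T q) → (T q → T p) → p ≡ q
T-injective {false} {false} f g = refl
T-injective {false} {true}  f g = contradiction _ g
T-injective {true}  {false} f g = contradiction _ f
T-injective {true}  {true}  f g = refl

Adjacent-sym : (G : Graph n) → Adjacent G x y → Adjacent G y x
Adjacent-sym {x = x} {y} G = subst T (adj-sym G x y)

Adjacent⇒≢ : (G : Graph n) → Adjacent G x y → x ≢ y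
Adjacent⇒≢ {x = x} G xx refl = subst T (adj-irrefl G x) xx

-- Local complementation and pivoting

-- With `xor` in place of `if`, adjacency after several complementations is a polynomial over the
-- two-element field, which the ring solver can simplify.
✶-adj : (G : Graph n) (u : Fin n) → x ≢ y →
        adj (G ✶ u) x y ≡ (adj G u x ∧ adj G u y) xor adj G x y
✶-adj {x = x} {y} G u x≢y rewrite dec-false (x ≟ y) x≢y with adj G u x | adj G u y
... | false | _     = refl
... | true  | false = refl
... | true  | true  = refl

✶-adj-centre : (G : Graph n) (u x : Fin n) → adj (G ✶ u) u x ≡ adj G u x
✶-adj-centre G u x rewrite adj-irrefl G u = refl

module _ (G : Graph n) {u v : Fin n} (uv : Adjacent G u v) where

  private
    uv≡true : adj G u v ≡ true
    uv≡true = Equivalence.to T-≡ uv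

    ✶-vu : adj (G ✶ u) v u ≡ true
    ✶-vu = trans (adj-sym (G ✶ u) v u) (trans (✶-adj-centre G u v) uv≡true)

    ✶-vx : v ≢ x → adj (G ✶ u) v x ≡ adj G u x xor adj G v x
    ✶-vx {x} v≢x = trans (✶-adj G u v≢x)
                         (cong (λ p → (p ∧ adj G u x) xor adj G v x) uv≡true)

    ✶✶-vx : v ≢ x → adj (G ✶ u ✶ v) v x ≡ adj G u x xor adj G v x
    ✶✶-vx {x} v≢x = trans (✶-adj-centre (G ✶ u) v x) (✶-vx v≢x)

    ✶✶-ux : u ≢ x → v ≢ x → adj (G ✶ u ✶ v) u x ≡ adj G v x
    ✶✶-ux {x} u≢x v≢x = begin
      adj (G ✶ u ✶ v) u x
        ≡⟨ ✶-adj (G ✶ u) v u≢x ⟩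
      (adj (G ✶ u) v u ∧ adj (G ✶ u) v x) xor adj (G ✶ u) u x
        ≡⟨ cong₂ _xor_ (cong₂ _∧_ ✶-vu (✶-vx v≢x)) (✶-adj-centre G u x) ⟩
      (adj G u x xor adj G v x) xor adj G u x
        ≡⟨ solve 2 (λ p q → (p :+ q) :+ p := q) refl (adj G u x) (adj G v x) ⟩
      adj G v x ∎
      where open xor-∧-Solver

    ✶✶-uv : adj (G ✶ u ✶ v) u v ≡ true
    ✶✶-uv = trans (adj-sym (G ✶ u ✶ v) u v) (trans (✶-adj-centre (G ✶ u) v u) ✶-vu)

  pivot-adj-ux : u ≢ x → v ≢ x → adj (pivot G u v) u x ≡ adj G v x
  pivot-adj-ux {x} u≢x v≢x = trans (✶-adj-centre (G ✶ u ✶ v) u x) (✶✶-ux u≢x v≢x)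

  pivot-adj-vx : u ≢ x → v ≢ x → adj (pivot G u v) v x ≡ adj G u x
  pivot-adj-vx {x} u≢x v≢x = begin
    adj (pivot G u v) v x
      ≡⟨ ✶-adj (G ✶ u ✶ v) u v≢x ⟩
    (adj (G ✶ u ✶ v) u v ∧ adj (G ✶ u ✶ v) u x) xor adj (G ✶ u ✶ v) v x
      ≡⟨ cong₂ _xor_ (cong₂ _∧_ ✶✶-uv (✶✶-ux u≢x v≢x)) (✶✶-vx v≢x) ⟩
    adj G v x xor (adj G u x xor adj G v x)
      ≡⟨ solve 2 (λ p q → q :+ (p :+ q) := p) refl (adj G u x) (adj G v x) ⟩
    adj G u x ∎
    where open xor-∧-Solver

  -- The pair is toggled by the determinant of (`ux`, `vx`) and (`uy`, `vy`) over the two-element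
  -- field, so exactly when these vectors are distinct and nonzero: edges are complemented between
  -- the neighbours of u only, of v only and of both.
  pivot-adj : u ≢ x → v ≢ x → u ≢ y → v ≢ y →
              adj (pivot G u v) x y ≡
              adj G x y xor ((adj G u x ∧ adj G v y) xor (adj G v x ∧ adj G u y))
  pivot-adj {x} {y} u≢x v≢x u≢y v≢y = by-cases (x ≟ y)
    where
    open xor-∧-Solver
    ux = adj G u x
    vx = adj G v x
    uy = adj G u y
    vy = adj G v y
    xy = adj G x y

    by-cases : Dec (x ≡ y) → adj (pivot G u v) x y ≡ xy xor ((ux ∧ vy) xor (vx ∧ uy))
    -- `✶-adj` does not cover a pair of equal vertices; here both sides vanish.
    by-cases (yes refl) = begin
      adj (pivot G u v) x x
        ≡⟨ adj-irrefl (pivot G u v) x ⟩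
      false
        ≡⟨ solve 2 (λ p q → con false := (p :* q) :+ (q :* p)) refl ux vx ⟩
      (ux ∧ vx) xor (vx ∧ ux)
        ≡⟨ cong (_xor ((ux ∧ vx) xor (vx ∧ ux))) (adj-irrefl G x) ⟨
      xy xor ((ux ∧ vx) xor (vx ∧ ux)) ∎
    by-cases (no x≢y) = begin
      adj (pivot G u v) x y
        ≡⟨ ✶-adj (G ✶ u ✶ v) u x≢y ⟩
      (adj (G ✶ u ✶ v) u x ∧ adj (G ✶ u ✶ v) u y) xor adj (G ✶ u ✶ v) x y
        ≡⟨ cong₂ _xor_ (cong₂ _∧_ (✶✶-ux u≢x v≢x) (✶✶-ux u≢y v≢y)) (✶-adj (G ✶ u) v x≢y) ⟩
      (vx ∧ vy) xor ((adj (G ✶ u) v x ∧ adj (G ✶ u) v y) xor adj (G ✶ u) x y)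
        ≡⟨ cong ((vx ∧ vy) xor_) (cong₂ _xor_ (cong₂ _∧_ (✶-vx v≢x) (✶-vx v≢y)) (✶-adj G u x≢y)) ⟩
      (vx ∧ vy) xor (((ux xor vx) ∧ (uy xor vy)) xor ((ux ∧ uy) xor xy))
        ≡⟨ solve 5 (λ ux vx uy vy xy →
             (vx :* vy) :+ (((ux :+ vx) :* (uy :+ vy)) :+ ((ux :* uy) :+ xy))
             := xy :+ ((ux :* vy) :+ (vx :* uy))) refl ux vx uy vy xy ⟩
      xy xor ((ux ∧ vy) xor (vx ∧ uy)) ∎

-- Two-colourings

Proper : Graph n → (Fin n → Bool) → Set
Proper G c = ∀ x y → Adjacent G x y → c x ≢ c y

-- Unlike the subset in `Bipartite`, a colouring function composes with vertex maps and is easily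
-- changed at single vertices.
TwoColourable : Graph n → Set
TwoColourable {n} G = Σ[ c ∈ (Fin n → Bool) ] Proper G c

¬both : ∀ {p q : Bool} → p ≢ true → q ≢ true → p ≡ q
¬both {false} {false} _  _ = refl
¬both {true}          p≢ _ = contradiction refl p≢
¬both {false} {true}  _ q≢ = contradiction refl q≢

bipartite⇒twoColourable : Bipartite G → TwoColourable G
bipartite⇒twoColourable {G = G} (S , indS , ind∁S) = (λ x → does (x ∈? S)) , proper
  where
  proper : Proper G (λ x → does (x ∈? S))
  proper x y xy with x ∈? S | y ∈? S
  ... | yes x∈S | yes y∈S = contradiction xy (indS x y x∈S y∈S)
  ... | yes _   | no _    = λ ()
  ... | no _    | yes _   = λ ()
  ... | no x∉S  | no y∉S  = contradiction xy (ind∁S x y (x∉p⇒x∈∁p x∉S) (x∉p⇒x∈∁p y∉S))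

twoColourable⇒bipartite : TwoColourable G → Bipartite G
twoColourable⇒bipartite {n} {G} (c , proper) = S , indS , ind∁S
  where
  S : Subset n
  S = Vec.tabulate c

  ∈S⇒ : x ∈ S → c x ≡ true
  ∈S⇒ {x} x∈S = trans (sym (lookup∘tabulate c x)) ([]=⇒lookup x∈S)

  ∈∁S⇒ : x ∈ ∁ S → c x ≢ true
  ∈∁S⇒ {x} x∈∁S cx = x∈∁p⇒x∉p x∈∁S (lookup⇒[]= x S (trans (lookup∘tabulate c x) cx))

  indS : Independent G S
  indS x y x∈S y∈S xy = proper x y xy (trans (∈S⇒ x∈S) (sym (∈S⇒ y∈S)))

  ind∁S : Independent G (∁ S)
  ind∁S x y x∈ y∈ xy = proper x y xy (¬both (∈∁S⇒ x∈) (∈∁S⇒ y∈))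

delete-twoColourable : (G : Graph (suc n)) (v : Fin (suc n)) →
                       TwoColourable G → TwoColourable (delete G v)
delete-twoColourable G v (c , proper) = c ∘ punchIn v , λ x y → proper _ _

-- Between two values, three changes amount to one, so the ends of a walk of three edges differ in
-- colour.
alternate : ∀ {p q r s : Bool} → p ≢ q → q ≢ r → r ≢ s → p ≢ s
alternate p≢q q≢r r≢s refl = q≢r (trans (¬-not (≢-sym p≢q)) (sym (¬-not r≢s)))

-- Read through `pivot-adj`: an edge xy after the pivot, off u and v, is an old edge or closes a
-- path x u v y or x v u y.
T-xor-∧ : ∀ p q r s t → T (p xor ((q ∧ r) xor (s ∧ t))) → T p ⊎ (T q × T r) ⊎ (T s × T t)
T-xor-∧ true  _     _     _    _    _ = inj₁ _
T-xor-∧ false true  true  _    _    _ = inj₂ (inj₁ _)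
T-xor-∧ false false _     true true _ = inj₂ (inj₂ _)
T-xor-∧ false true  false true true _ = inj₂ (inj₂ _)

pivot-twoColourable : (G : Graph n) → Adjacent G u v → TwoColourable G → TwoColourable (pivot G u v)
pivot-twoColourable {n} {u} {v} G uv (c , proper) =
  (λ x → colour x (u ≟ x) (v ≟ x)) , λ x y xy → colour-proper xy (u ≟ x) (v ≟ x) (u ≟ y) (v ≟ y)
  where
  -- With pivot defined as G ✶ u ✶ v ✶ u, pivoting also exchanges the labels u and v.
  colour : ∀ x → Dec (u ≡ x) → Dec (v ≡ x) → Bool
  colour x (yes _) _       = c v
  colour x (no _)  (yes _) = c u
  colour x (no _)  (no _)  = c x

  colour-proper : Adjacent (pivot G u v) x y →
                  ∀ u≟x v≟x u≟y v≟y → colour x u≟x v≟x ≢ colour y u≟y v≟y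
  colour-proper xy (yes refl) _          (yes refl) _          =
    contradiction refl (Adjacent⇒≢ (pivot G u v) xy)
  colour-proper xy (yes refl) _          (no _)     (yes refl) = ≢-sym (proper u v uv)
  colour-proper xy (yes refl) _          (no u≢y)   (no v≢y)   =
    proper v _ (subst T (pivot-adj-ux G uv u≢y v≢y) xy)
  colour-proper xy (no _)     (yes refl) (yes refl) _          = proper u v uv
  colour-proper xy (no _)     (yes refl) (no _)     (yes refl) =
    contradiction refl (Adjacent⇒≢ (pivot G u v) xy)
  colour-proper xy (no _)     (yes refl) (no u≢y)   (no v≢y)   =
    proper u _ (subst T (pivot-adj-vx G uv u≢y v≢y) xy)
  colour-proper xy (no u≢x)   (no v≢x)   (yes refl) _          =
    ≢-sym (proper v _ (subst T (pivot-adj-ux G uv u≢x v≢x) (Adjacent-sym (pivot G u v) xy)))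
  colour-proper xy (no u≢x)   (no v≢x)   (no _)     (yes refl) =
    ≢-sym (proper u _ (subst T (pivot-adj-vx G uv u≢x v≢x) (Adjacent-sym (pivot G u v) xy)))
  colour-proper {x} {y} xy (no u≢x) (no v≢x) (no u≢y) (no v≢y)
    with T-xor-∧ (adj G x y) (adj G u x) (adj G v y) (adj G v x) (adj G u y)
           (subst T (pivot-adj G uv u≢x v≢x u≢y v≢y) xy)
  ... | inj₁ xy′              = proper x y xy′
  ... | inj₂ (inj₁ (ux , vy)) = alternate (≢-sym (proper u x ux)) (proper u v uv) (proper v y vy)
  ... | inj₂ (inj₂ (vx , uy)) =
    alternate (≢-sym (proper v x vx)) (≢-sym (proper u v uv)) (proper u y uy)

pivotMinor-twoColourable : IsPivotMinorOf H G → TwoColourable G → TwoColourable H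
pivotMinor-twoColourable ε                          = λ tc → tc
pivotMinor-twoColourable (deleteVertex G v ◅ steps) =
  pivotMinor-twoColourable steps ∘ delete-twoColourable G v
pivotMinor-twoColourable (pivotEdge G u v uv ◅ steps) =
  pivotMinor-twoColourable steps ∘ pivot-twoColourable G uv

≅-twoColourable : G ≅ H → TwoColourable G → TwoColourable H
≅-twoColourable {H = H} (f , f-adj) (c , proper) = c ∘ from , λ x y xy →
  proper (from x) (from y)
    (subst T (trans (sym (cong₂ (adj H) (strictlyInverseˡ x) (strictlyInverseˡ y)))
                    (sym (f-adj (from x) (from y)))) xy)
  where open Inverse f

C₃-¬twoColourable : ¬ TwoColourable C₃
C₃-¬twoColourable (c , proper) =
  alternate (proper zero (suc zero) _) (proper (suc zero) (suc (suc zero)) _)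
            (proper (suc (suc zero)) zero _) refl

twoColourable⇒C₃-free : TwoColourable G → PivotMinorFree C₃ G
twoColourable⇒C₃-free tc (_ , K , minor , iso) =
  C₃-¬twoColourable (≅-twoColourable {G = K} {H = C₃} iso (pivotMinor-twoColourable minor tc))

-- Induced subgraphs and pivot-minors

HasPivotMinor : Graph m → Graph n → Set
HasPivotMinor H G = ∃[ k ] Σ[ K ∈ Graph k ] IsPivotMinorOf K G × K ≅ H

-- Vertices outside the image are deleted one by one, by induction on n; once f is onto, its inverse
-- is the isomorphism.
inducedSubgraph⇒pivotMinor : (G : Graph n) → IsInducedSubgraphOf H G → HasPivotMinor H G
inducedSubgraph⇒pivotMinor {n} {H = H} G (f , f-inj , f-adj)
  with all? (λ v → any? (λ i → f i ≟ v))
... | yes f-surj = _ , G , ε , mk↔ₛ′ f⁻¹ f (λ i → f-inj (f∘f⁻¹ (f i))) f∘f⁻¹ , f⁻¹-adj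
  where
  f⁻¹ = proj₁ ∘ f-surj
  f∘f⁻¹ : ∀ v → f (f⁻¹ v) ≡ v
  f∘f⁻¹ v = proj₂ (f-surj v)
  f⁻¹-adj : ∀ x y → adj G x y ≡ adj H (f⁻¹ x) (f⁻¹ y)
  f⁻¹-adj x y = trans (cong₂ (adj G) (sym (f∘f⁻¹ x)) (sym (f∘f⁻¹ y))) (sym (f-adj _ _))
inducedSubgraph⇒pivotMinor {zero} G (f , f-inj , f-adj) | no ¬f-surj = contradiction (λ ()) ¬f-surj
inducedSubgraph⇒pivotMinor {suc n} {m} {H = H} G (f , f-inj , f-adj) | no ¬f-surj
  with ¬∀⟶∃¬ (suc n) _ (λ v → any? (λ i → f i ≟ v)) ¬f-surj
... | v , v∉f =
  let k , K , minor , iso = inducedSubgraph⇒pivotMinor {H = H} (delete G v) (f′ , f′-inj , f′-adj)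
  in k , K , deleteVertex G v ◅ minor , iso
  where
  v≢f : ∀ i → v ≢ f i
  v≢f i v≡fi = v∉f (i , sym v≡fi)
  f′ : Fin m → Fin n
  f′ i = punchOut (v≢f i)
  f′-inj : Injective _≡_ _≡_ f′
  f′-inj {i} {j} = f-inj ∘ punchOut-injective (v≢f i) (v≢f j)
  f′-adj : ∀ i j → adj H i j ≡ adj (delete G v) (f′ i) (f′ j)
  f′-adj i j = trans (f-adj i j)
    (sym (cong₂ (adj G) (punchIn-punchOut (v≢f i)) (punchIn-punchOut (v≢f j))))

pivot-hasPivotMinor : (G : Graph n) → Adjacent G u v → HasPivotMinor H (pivot G u v) → HasPivotMinor H G
pivot-hasPivotMinor G uv (k , K , minor , iso) = k , K , pivotEdge G _ _ uv ◅ minor , iso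

-- Shortening odd cycles by pivoting

<⇒≡ᵇ-false : m < n → (m ≡ᵇ n) ≡ false
<⇒≡ᵇ-false {m} {n} m<n = T-injective (λ m≡ᵇn → contradiction (≡ᵇ⇒≡ m n m≡ᵇn) (<⇒≢ m<n)) λ ()

∣toℕ-toℕ∣<n : (i j : Fin (suc n)) → ∣ toℕ i - toℕ j ∣ < suc n
∣toℕ-toℕ∣<n i j = s≤s (≤-trans (∣m-n∣≤m⊔n (toℕ i) (toℕ j)) (⊔-lub (toℕ≤pred[n] i) (toℕ≤pred[n] j)))

-- Among 2, …, k + 4, the only neighbour of 0 is k + 4 and that of 1 is 2, so pivoting the edge 01
-- only adds the edge between 2 and k + 4.
pivot-shortens-cycle : ∀ k {3≤3+k : 3 ≤ 3 + k} {3≤5+k : 3 ≤ 5 + k} (i j : Fin (3 + k)) →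
  let C = cycle (5 + k) 3≤5+k; i′ = suc (suc i); j′ = suc (suc j) in
  adj (cycle (3 + k) 3≤3+k) i j ≡
  adj C i′ j′ xor ((adj C zero i′ ∧ adj C (suc zero) j′) xor (adj C (suc zero) i′ ∧ adj C zero j′))
pivot-shortens-cycle k zero          zero          = refl
pivot-shortens-cycle k zero          (suc zero)    = refl
pivot-shortens-cycle k zero          (suc (suc j))
  rewrite <⇒≡ᵇ-false (m≤n⇒m≤1+n (toℕ<n j)) = refl
pivot-shortens-cycle k (suc zero)    zero          = refl
pivot-shortens-cycle k (suc (suc i)) zero
  rewrite <⇒≡ᵇ-false (m≤n⇒m≤1+n (toℕ<n i))
        | ∧-identityʳ (toℕ i ≡ᵇ k)
        | ∧-zeroʳ (toℕ i ≡ᵇ suc k) = sym (xor-identityʳ _)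
-- Neither vertex is 2 here, so 1 is adjacent to neither and both products vanish; the difference of
-- indices is too small for the closing edge of either cycle.
pivot-shortens-cycle k (suc i)       (suc j)
  rewrite <⇒≡ᵇ-false (∣toℕ-toℕ∣<n i j)
        | <⇒≡ᵇ-false (≤-trans (∣toℕ-toℕ∣<n i j) (m≤n+m (2 + k) 2))
        | <⇒≡ᵇ-false (toℕ<n i)
        | <⇒≡ᵇ-false (toℕ<n j)
        | ∧-zeroʳ (toℕ i ≡ᵇ suc k) = sym (xor-identityʳ _)

-- Each pivot shortens the cycle by two, down to the triangle. `parity` reduces along two
-- successors, so the proof `odd` passes unchanged to the recursive call.
inducedCycle⇒C₃-pivotMinor : ∀ k (3≤k : 3 ≤ k) → parity k ≡ 1ℙ → (G : Graph n) →
                             IsInducedSubgraphOf (cycle k 3≤k) G → HasPivotMinor C₃ G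
inducedCycle⇒C₃-pivotMinor 1 (s≤s ()) _ G _
inducedCycle⇒C₃-pivotMinor 3 _ _ G C₃⊆G = inducedSubgraph⇒pivotMinor {H = C₃} G C₃⊆G
inducedCycle⇒C₃-pivotMinor (suc (suc (suc (suc (suc k))))) 3≤5+k odd G (f , f-inj , f-adj) =
  pivot-hasPivotMinor {H = C₃} G st
    (inducedCycle⇒C₃-pivotMinor (suc (suc (suc k))) 3≤3+k odd (pivot G s t) (f′ , f′-inj , f′-adj))
  where
  3≤3+k : 3 ≤ 3 + k
  3≤3+k = s≤s (s≤s (s≤s z≤n))
  f′ : Fin (3 + k) → Fin _
  f′ i = f (suc (suc i))
  s = f zero
  t = f (suc zero)
  st : Adjacent G s t
  st = subst T (f-adj zero (suc zero)) _
  s≢f′ : ∀ i → s ≢ f′ i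
  s≢f′ i s≡f′ with () ← f-inj s≡f′
  t≢f′ : ∀ i → t ≢ f′ i
  t≢f′ i t≡f′ with () ← f-inj t≡f′
  f′-inj : Injective _≡_ _≡_ f′
  f′-inj = suc-injective ∘ suc-injective ∘ f-inj
  f′-adj : ∀ i j → adj (cycle (3 + k) 3≤3+k) i j ≡ adj (pivot G s t) (f′ i) (f′ j)
  f′-adj i j = begin
    adj (cycle (3 + k) 3≤3+k) i j
      ≡⟨ pivot-shortens-cycle k {3≤3+k} {3≤5+k} i j ⟩
    adj C i′ j′ xor ((adj C zero i′ ∧ adj C (suc zero) j′) xor (adj C (suc zero) i′ ∧ adj C zero j′))
      ≡⟨ cong₂ _xor_ (f-adj i′ j′)
           (cong₂ _xor_ (cong₂ _∧_ (f-adj zero i′) (f-adj (suc zero) j′))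
                        (cong₂ _∧_ (f-adj (suc zero) i′) (f-adj zero j′))) ⟩
    adj G (f′ i) (f′ j) xor ((adj G s (f′ i) ∧ adj G t (f′ j)) xor (adj G t (f′ i) ∧ adj G s (f′ j)))
      ≡⟨ pivot-adj G st (s≢f′ i) (t≢f′ i) (s≢f′ j) (t≢f′ j) ⟨
    adj (pivot G s t) (f′ i) (f′ j) ∎
    where
    C = cycle (5 + k) 3≤5+k
    i′ j′ : Fin (5 + k)
    i′ = suc (suc i)
    j′ = suc (suc j)

Odd⇒parity≡1 : Odd n → parity n ≡ 1ℙ
Odd⇒parity≡1 (k , refl) = trans (ℙₚ.+-homo-+ 1 (2 * k)) (cong _⁻¹ (ℙₚ.*-homo-* 2 k))

parity≡1⇒Odd : ∀ n → parity n ≡ 1ℙ → Odd n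
parity≡1⇒Odd 1             _   = 0 , refl
parity≡1⇒Odd (suc (suc n)) odd with k , refl ← parity≡1⇒Odd n odd = suc k , cong suc (sym (*-suc 2 k))

C₃-free⇒¬inducedOddCycle : (G : Graph n) → PivotMinorFree C₃ G → ¬ HasInducedOddCycle G
C₃-free⇒¬inducedOddCycle G free (k , 3≤k , odd , cycle⊆G) =
  free (inducedCycle⇒C₃-pivotMinor k 3≤k (Odd⇒parity≡1 odd) G cycle⊆G)

-- Walks

parity-suc : ∀ n → parity (suc n) ≡ parity n ⁻¹
parity-suc = ℙₚ.+-homo-+ 1

module _ (G : Graph n) where

  data Walk : ℕ → Fin n → Fin n → Set where
    []  : Walk 0 a a
    _∷_ : Adjacent G a b → Walk k b c → Walk (suc k) a c

  walk? : ∀ k a b → Dec (Walk k a b)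
  walk? zero    a b = map′ (λ { refl → [] }) (λ { [] → refl }) (a ≟ b)
  walk? (suc k) a b = map′ (λ { (_ , e , w) → e ∷ w }) (λ { (e ∷ w) → _ , e , w })
                           (any? (λ c → T? (adj G a c) ×-dec walk? k c b))

  _++_ : Walk k a b → Walk l b c → Walk (k + l) a c
  []      ++ w′ = w′
  (e ∷ w) ++ w′ = e ∷ (w ++ w′)

  reverseAppend : Walk k a b → Walk l a c → Walk (k + l) b c
  reverseAppend                                 []      w′ = w′
  reverseAppend {suc k} {b = b} {l = l} {c = c} (e ∷ w) w′ =
    subst (λ m → Walk m b c) (+-suc k l) (reverseAppend w (Adjacent-sym G e ∷ w′))

  vertex : Walk k a b → ℕ → Fin n
  vertex {a = a} w       zero    = a
  -- Past its end the walk rests at its last vertex; only indices up to k are used.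
  vertex {a = a} []      (suc i) = a
  vertex         (e ∷ w) (suc i) = vertex w i

  segment : (w : Walk k a b) → ∀ {i j} → i ≤ j → j ≤ k → Walk (j ∸ i) (vertex w i) (vertex w j)
  segment w       {j = zero}  z≤n       _         = []
  segment (e ∷ w) {j = suc j} z≤n       (s≤s j≤k) = e ∷ segment w z≤n j≤k
  segment (e ∷ w)             (s≤s i≤j) (s≤s j≤k) = segment w i≤j j≤k

  -- A `segment` up to k would end at `vertex w k`, which is only propositionally b.
  after : (w : Walk k a b) → ∀ {i} → i ≤ k → Walk (k ∸ i) (vertex w i) b
  after w       z≤n       = w
  after (e ∷ w) (s≤s i≤k) = after w i≤k

  single : k ≡ 1 → Walk k a b → Adjacent G a b
  single refl (e ∷ []) = e

  -- Shortest odd closed walks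

  OddClosedWalk : ℕ → Set
  OddClosedWalk k = parity k ≡ 1ℙ × ∃[ a ] Walk k a a

  oddClosedWalk? : ∀ k → Dec (OddClosedWalk k)
  oddClosedWalk? k = (parity k ℙₚ.≟ 1ℙ) ×-dec any? (λ a → walk? k a a)

  -- x and y lie on a shortest odd closed walk and split it into arcs p and q. Exactly one of p and q
  -- has odd length, and a chord xy closes up the other one to an odd closed walk.
  module Arcs (noShorter : ∀ {l} → l < k → ¬ OddClosedWalk l) (odd : parity k ≡ 1ℙ)
              {d e} (d+e≡k : d + e ≡ k) (0<d : 0 < d) (0<e : 0 < e)
              (p : Walk d x y) (q : Walk e y x) where

    private
      d<k : d < k
      d<k = subst (d <_) d+e≡k (m<m+n d 0<e)

      e<k : e < k
      e<k = subst (e <_) d+e≡k (m<n+m e 0<d)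

      parities : parity d ℙ.+ parity e ≡ 1ℙ
      parities = trans (sym (ℙₚ.+-homo-+ d e)) (trans (cong parity d+e≡k) odd)

    -- If x and y coincided, both arcs would be closed, and the odd one is shorter than k because
    -- the other is nonempty.
    distinct : x ≢ y
    distinct refl with parity d in d-odd | parity e in e-odd | parities
    ... | 1ℙ | _  | _ = noShorter d<k (d-odd , x , p)
    ... | 0ℙ | 1ℙ | _ = noShorter e<k (e-odd , x , q)

    -- If d is even, p and the chord form an odd closed walk of length d + 1, so minimality gives d
    -- + e ≤ d + 1 and e is 1; symmetrically if e is even.
    chord⇒ : Adjacent G x y → d ≡ 1 ⊎ e ≡ 1
    chord⇒ xy with parity d in d-even | parity e in e-even | parities
    ... | 0ℙ | _  | _ = inj₂ (≤-antisym (+-cancelˡ-≤ d e 1 d+e≤d+1) 0<e)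
      where
      d+e≤d+1 : d + e ≤ d + 1
      d+e≤d+1 rewrite d+e≡k | +-comm d 1 = ≮⇒≥ λ 1+d<k →
        noShorter 1+d<k (trans (parity-suc d) (cong _⁻¹ d-even) , y , Adjacent-sym G xy ∷ p)
    ... | 1ℙ | 0ℙ | _ = inj₁ (≤-antisym (+-cancelʳ-≤ e d 1 d+e≤1+e) 0<d)
      where
      d+e≤1+e : d + e ≤ 1 + e
      d+e≤1+e rewrite d+e≡k = ≮⇒≥ λ 1+e<k →
        noShorter 1+e<k (trans (parity-suc e) (cong _⁻¹ e-even) , x , xy ∷ q)

    ⇒chord : d ≡ 1 ⊎ e ≡ 1 → Adjacent G x y
    ⇒chord (inj₁ d≡1) = single d≡1 p
    ⇒chord (inj₂ e≡1) = Adjacent-sym G (single e≡1 q)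

    -- The right side is adjacency in a cycle of length k for indices at difference d; d = k - 1
    -- expresses e = 1.
    adj-arcs : adj G x y ≡ (d ≡ᵇ 1) ∨ (d ≡ᵇ pred k)
    adj-arcs = T-injective
      (from T-∨ ∘ Sum.map (≡⇒≡ᵇ d 1) (≡⇒≡ᵇ d (pred k) ∘ e≡1⇒d≡pred[k]) ∘ chord⇒)
      (⇒chord ∘ Sum.map (≡ᵇ⇒≡ d 1) (d≡pred[k]⇒e≡1 ∘ ≡ᵇ⇒≡ d (pred k)) ∘ to T-∨)
      where
      open Equivalence using (to; from)
      e≡1⇒d≡pred[k] : e ≡ 1 → d ≡ pred k
      e≡1⇒d≡pred[k] refl = trans (cong pred (+-comm 1 d)) (cong pred d+e≡k)
      pred[k]+1≡k : pred k + 1 ≡ k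
      pred[k]+1≡k = trans (+-comm (pred k) 1) (suc-pred k {{>-nonZero (≤-trans (s≤s z≤n) d<k)}})
      d≡pred[k]⇒e≡1 : d ≡ pred k → e ≡ 1
      d≡pred[k]⇒e≡1 refl = +-cancelˡ-≡ (pred k) e 1 (trans d+e≡k (sym pred[k]+1≡k))

  -- The walk itself, read position by position, is the embedding. The only odd length below 3 is 1,
  -- which would be a loop.
  shortestOddClosedWalk⇒inducedOddCycle :
    (∀ {l} → l < k → ¬ OddClosedWalk l) → OddClosedWalk k → HasInducedOddCycle G
  shortestOddClosedWalk⇒inducedOddCycle {1} _ (_ , a , e ∷ []) = contradiction refl (Adjacent⇒≢ G e)
  shortestOddClosedWalk⇒inducedOddCycle {k@(suc (suc (suc _)))} noShorter (odd , a , w) =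
    k , 3≤k , parity≡1⇒Odd k odd , f , f-inj , f-adj
    where
    3≤k : 3 ≤ k
    3≤k = s≤s (s≤s (s≤s z≤n))

    f : Fin k → Fin n
    f i = vertex w (toℕ i)

    module _ {i j : Fin k} (i<j : toℕ i < toℕ j) where

      private
        i≤j = <⇒≤ i<j
        j≤k = <⇒≤ (toℕ<n j)

      arcs : (toℕ j ∸ toℕ i) + ((k ∸ toℕ j) + toℕ i) ≡ k
      arcs = begin
        (toℕ j ∸ toℕ i) + ((k ∸ toℕ j) + toℕ i)
          ≡⟨ cong ((toℕ j ∸ toℕ i) +_) (+-comm (k ∸ toℕ j) (toℕ i)) ⟩
        (toℕ j ∸ toℕ i) + (toℕ i + (k ∸ toℕ j)) ≡⟨ +-assoc (toℕ j ∸ toℕ i) (toℕ i) (k ∸ toℕ j) ⟨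
        (toℕ j ∸ toℕ i) + toℕ i + (k ∸ toℕ j)   ≡⟨ cong (_+ (k ∸ toℕ j)) (m∸n+n≡m i≤j) ⟩
        toℕ j + (k ∸ toℕ j)                     ≡⟨ m+[n∸m]≡n j≤k ⟩
        k ∎

      -- The first arc runs from position i to j; the second from j to the end of the walk, which is
      -- its start a again, and on to i. It is nonempty because j < k.
      open Arcs noShorter odd arcs (m<n⇒0<n∸m i<j)
                (≤-trans (m<n⇒0<n∸m (toℕ<n j)) (m≤m+n (k ∸ toℕ j) (toℕ i)))
                (segment w i≤j j≤k)
                (after w j≤k ++ segment w z≤n (≤-trans i≤j j≤k)) public

      cycle-adj-< : adj (cycle k 3≤k) i j ≡ adj G (f i) (f j)
      cycle-adj-< = trans (cong (λ d → (d ≡ᵇ 1) ∨ (d ≡ᵇ pred k)) (m≤n⇒∣m-n∣≡n∸m i≤j)) (sym adj-arcs)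

    f-inj : Injective _≡_ _≡_ f
    f-inj {i} {j} fi≡fj with <-cmp (toℕ i) (toℕ j)
    ... | tri< i<j _ _ = contradiction fi≡fj (distinct i<j)
    ... | tri≈ _ i≡j _ = toℕ-injective i≡j
    ... | tri> _ _ j<i = contradiction (sym fi≡fj) (distinct j<i)

    f-adj : ∀ i j → adj (cycle k 3≤k) i j ≡ adj G (f i) (f j)
    f-adj i j with <-cmp (toℕ i) (toℕ j)
    ... | tri< i<j _ _ = cycle-adj-< i<j
    ... | tri≈ _ i≡j _ with refl ← toℕ-injective i≡j =
      trans (adj-irrefl (cycle k 3≤k) i) (sym (adj-irrefl G (f i)))
    ... | tri> _ _ j<i =
      trans (adj-sym (cycle k 3≤k) i j) (trans (cycle-adj-< j<i) (adj-sym G (f j) (f i)))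

  -- Whether a shorter odd closed walk exists is decidable by bounded search, so the descent to a
  -- shortest one is constructive.
  oddClosedWalk⇒inducedOddCycle : ∀ k → OddClosedWalk k → HasInducedOddCycle G
  oddClosedWalk⇒inducedOddCycle = <-rec _ step
    where
    step : ∀ k → (∀ {l} → l < k → OddClosedWalk l → HasInducedOddCycle G) →
           OddClosedWalk k → HasInducedOddCycle G
    step k rec walk with anyUpTo? oddClosedWalk? k
    ... | yes (l , l<k , shorter) = rec l<k shorter
    ... | no ¬shorter             =
      shortestOddClosedWalk⇒inducedOddCycle (λ l<k shorter → ¬shorter (_ , l<k , shorter)) walk

  -- Colouring a graph without odd closed walks

  -- Colouring needs only the parity of a walk; hiding the length lets parities add under
  -- composition.
  Path : Parity → Fin n → Fin n → Set
  Path p a b = ∃[ k ] parity k ≡ p × Walk k a b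

  infixr 5 _◇_

  _◇_ : ∀ {p q} → Path p a b → Path q b c → Path (p ℙ.+ q) a c
  (k , refl , w) ◇ (l , refl , w′) = k + l , ℙₚ.+-homo-+ k l , w ++ w′

  edge : Adjacent G a b → Path 1ℙ a b
  edge e = 1 , refl , e ∷ []

  flip : ∀ {p} → Path p a b → Path p b a
  flip (k , refl , w) = k + 0 , cong parity (+-identityʳ k) , reverseAppend w []

  -- A union-find state after the given edges have been processed; pairs of non-adjacent vertices are
  -- allowed in the list and impose no condition.
  record Forest (edges : List (Fin n × Fin n)) : Set where
    field
      root       : Fin n → Fin n
      depth      : Fin n → Parity
      toRoot     : ∀ x → Path (depth x) x (root x)
      compatible : All (λ (a , b) → Adjacent G a b → root a ≡ root b × depth a ≢ depth b) edges

  module _ (noOddClosedWalk : ∀ a → ¬ Path 1ℙ a a) where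

    addEdge : ∀ {edges} a b → Forest edges → Forest ((a , b) ∷ edges)
    addEdge a b F with T? (adj G a b)
    ... | no ¬ab = record { Forest F hiding (compatible)
                         ; compatible = (λ ab → contradiction ab ¬ab) ∷ Forest.compatible F }
    ... | yes ab with Forest.root F a ≟ Forest.root F b
    ...   | yes ra≡rb = record { Forest F hiding (compatible)
                         ; compatible = (λ _ → ra≡rb , depths) ∷ Forest.compatible F }
      where
      open Forest F
      depths : depth a ≢ depth b
      -- Equal depths would make the walk from a over the edge to b, to the common root and back to
      -- a odd.
      depths da≡db = noOddClosedWalk a
        (subst (λ p → Path (p ⁻¹) a a)
               (trans (cong (ℙ._+ depth a) (sym da≡db)) (ℙₚ.p+p≡0ℙ (depth a)))
               (edge ab ◇ toRoot b ◇ flip (subst (Path (depth a) a) ra≡rb (toRoot a))))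
    ...   | no ra≢rb = record
      { root       = newRoot ∘ root
      ; depth      = λ x → offset (root x) ℙ.+ depth x
      ; toRoot     = λ x → subst (λ p → Path p x (newRoot (root x)))
                             (ℙₚ.+-comm (depth x) (offset (root x))) (toRoot x ◇ bridge (root x))
      ; compatible = (λ _ → new-root , new-depth) ∷ All.map old compatible
      }
      where
      open Forest F

      newRoot : Fin n → Fin n
      newRoot r = if does (r ≟ root b) then root a else r

      -- The tree of b is attached to the root of a. The offset is the parity of the walk from
      -- `root b` through b and a to `root a`; the inversion counts the edge ba.
      offset : Fin n → Parity
      offset r = if does (r ≟ root b) then depth b ℙ.+ (depth a ⁻¹) else 0ℙ

      bridge : ∀ r → Path (offset r) r (newRoot r)
      bridge r with r ≟ root b
      ... | yes refl = flip (toRoot b) ◇ edge (Adjacent-sym G ab) ◇ toRoot a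
      ... | no _     = 0 , refl , []

      -- Both ends of an earlier edge lie in the same tree, so they receive the same offset, which
      -- cancels.
      old : ∀ {e : Fin n × Fin n} → let x , y = e in
            (Adjacent G x y → root x ≡ root y × depth x ≢ depth y) →
            Adjacent G x y → newRoot (root x) ≡ newRoot (root y) ×
                             offset (root x) ℙ.+ depth x ≢ offset (root y) ℙ.+ depth y
      old {x , y} compat xy with rx≡ry , dx≢dy ← compat xy rewrite rx≡ry =
        refl , λ eq → dx≢dy (ℙₚ.+-cancelˡ-≡ (offset (root y)) _ _ eq)

      new-root : newRoot (root a) ≡ newRoot (root b)
      new-root rewrite dec-false (root a ≟ root b) ra≢rb | dec-true (root b ≟ root b) refl = refl

      -- The new depth of b is `depth b` + (1 + `depth a`) + `depth b`, that is, 1 + `depth a`,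
      -- while a keeps its depth.
      new-depth : offset (root a) ℙ.+ depth a ≢ offset (root b) ℙ.+ depth b
      new-depth rewrite dec-false (root a ≟ root b) ra≢rb | dec-true (root b ≟ root b) refl
        with depth a | depth b
      ... | 0ℙ | 0ℙ = λ ()
      ... | 0ℙ | 1ℙ = λ ()
      ... | 1ℙ | 0ℙ = λ ()
      ... | 1ℙ | 1ℙ = λ ()

    forest : ∀ edges → Forest edges
    forest []                = record
      { root = λ x → x ; depth = λ _ → 0ℙ ; toRoot = λ _ → 0 , refl , [] ; compatible = [] }
    forest ((a , b) ∷ edges) = addEdge a b (forest edges)

    noOddClosedWalk⇒twoColourable : TwoColourable G
    noOddClosedWalk⇒twoColourable = (λ x → does (depth x ℙₚ.≟ 0ℙ)) , proper
      where
      -- Processing all ordered pairs of vertices makes every edge compatible.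
      open Forest (forest (cartesianProduct (allFin n) (allFin n)))
      proper : Proper G (λ x → does (depth x ℙₚ.≟ 0ℙ))
      proper x y xy with proj₂ (All.lookup compatible (∈-cartesianProduct⁺ (∈-allFin x) (∈-allFin y)) xy)
      ... | dx≢dy with depth x | depth y
      ...   | 0ℙ | 0ℙ = contradiction refl dx≢dy
      ...   | 0ℙ | 1ℙ = λ ()
      ...   | 1ℙ | 0ℙ = λ ()
      ...   | 1ℙ | 1ℙ = contradiction refl dx≢dy

  ¬inducedOddCycle⇒twoColourable : ¬ HasInducedOddCycle G → TwoColourable G
  ¬inducedOddCycle⇒twoColourable ¬cycle = noOddClosedWalk⇒twoColourable
    λ a (k , odd , w) → ¬cycle (oddClosedWalk⇒inducedOddCycle k (odd , a , w))

proposition5p1 : ∀ (n : ℕ) (G : Graph n) →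
    (PivotMinorFree C₃ G ⇔ (¬ HasInducedOddCycle G)) ×
    ((¬ HasInducedOddCycle G) ⇔ Bipartite G)
proposition5p1 n G =
  -- Both equivalences come from the circle of implications (i) to (ii) to two-colourability, hence
  -- (iii), and back to (i).
  mk⇔ (C₃-free⇒¬inducedOddCycle G)
      (twoColourable⇒C₃-free {G = G} ∘ ¬inducedOddCycle⇒twoColourable G) ,
  mk⇔ (twoColourable⇒bipartite {G = G} ∘ ¬inducedOddCycle⇒twoColourable G)
      (C₃-free⇒¬inducedOddCycle G ∘ twoColourable⇒C₃-free {G = G} ∘ bipartite⇒twoColourable {G = G})
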